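{- Let $t_j^i=\binom{i}{j}$ for $0\le j\le i$ (Pascal's triangle), and let $b_n=\sum_{i=0}^{n}\sum_{j=0}^{i}\binom{n}{j,\,n-i,\,i-j}t_j^i$ be its tetrahedron coefficient transform. Then for all $n\ge 0$, $$b_n=\sum_{\ell=0}^{n}\binom{n}{\ell}\binom{2\ell}{\ell},$$ i.e., $(b_n)$ is the binomial transform of the central binomial coefficients.
   Context: For non-negative integers $p,q,r$ with $p+q+r=n$, $\binom{n}{p,q,r}=\frac{n!}{p!\,q!\,r!}$ denotes the tetrahedron trinomial coefficient. The binomial transform of a sequence $(a_\ell)$ is the sequence $\sum_{\ell=0}^n\binom{n}{\ell}a_\ell$. -}

module Defs where

open import Data.List.Base using (applyUpTo)
open import Data.Nat.Base using (ℕ; suc; _*_; _∸_; _/_; _!; NonZero)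
open import Data.Nat.Combinatorics using (_C_)
open import Data.Nat.ListAction using (sum)
open import Data.Nat.Properties using (m*n≢0; _!≢0; _!*_!≢0)

-- Both endpoints are included: ∑[ i ≤ n ] f i = f 0 + ⋯ + f n.
sumUpTo : ℕ → (ℕ → ℕ) → ℕ
sumUpTo n f = sum (applyUpTo f (suc n))

infix 5 sumUpTo
syntax sumUpTo n (λ i → x) = ∑[ i ≤ n ] x

-- Meaningful only when p + q + r ≡ n, in which case the division is exact.
trinomial : (n p q r : ℕ) → ℕ
trinomial n p q r = n ! / (p ! * q ! * r !)
  where
  instance
    p!q!r!≢0 : NonZero (p ! * q ! * r !)
    p!q!r!≢0 = m*n≢0 (p ! * q !) (r !) {{p !* q !≢0}} {{r !≢0}}

-- A triangle is encoded as a function t with t i j the j-th entry of row i.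
-- Only entries with j ≤ i ≤ n are used, so neither ∸ truncates and
-- j + (n ∸ i) + (i ∸ j) ≡ n.
tetrahedronTransform : (ℕ → ℕ → ℕ) → ℕ → ℕ
tetrahedronTransform t n =
  ∑[ i ≤ n ] ∑[ j ≤ i ] trinomial n j (n ∸ i) (i ∸ j) * t i j

binomialTransform : (ℕ → ℕ) → ℕ → ℕ
binomialTransform a n = ∑[ l ≤ n ] (n C l) * a l

pascal : ℕ → ℕ → ℕ
pascal i j = i C j

centralBinomial : ℕ → ℕ
centralBinomial l = (2 * l) C l

{-# OPTIONS --safe #-}

-- For j ≤ i ≤ n the trinomial coefficient factors as (n C i) * (i C j), so the
-- inner sum of the transform is (n C i) times ∑ⱼ (i C j)², which equals (2 i) C i
-- by Vandermonde's identity and the symmetry of binomial coefficients.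
module Submission where

open import Algebra.Properties.CommutativeSemigroup using (interchange; x∙yz≈y∙xz)
open import Data.Nat.Base using (ℕ; zero; suc; _+_; _*_; _∸_; _/_; _!; _≤_; z≤n; s≤s; NonZero)
open import Data.Nat.Combinatorics using (_C_; nCk≡n!/k![n-k]!; nCk≡nC[n∸k]; nCk+nC[k+1]≡[n+1]C[k+1]; k![n∸k]!∣n!)
open import Data.Nat.DivMod using (m*n/n≡m; m/n*n≡m)
open import Data.Nat.Properties using (+-identityʳ; *-identityˡ; *-assoc; *-zeroʳ; *-distribˡ-+; *-distribʳ-+; +-commutativeSemigroup; m*n≢0; _!≢0; _!*_!≢0)
open import Data.Nat.Tactic.RingSolver using (solve-∀)
open import Relation.Binary.PropositionalEquality using (_≡_; refl; sym; trans; cong; cong₂; module ≡-Reasoning)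
open import Defs

open ≡-Reasoning

-- The bound `i ≤ n` is handed to the pointwise proof because binomial symmetry and the trinomial
-- factorization are available only in range.
sumUpTo-cong : ∀ n {f g : ℕ → ℕ} → (∀ i → i ≤ n → f i ≡ g i) → sumUpTo n f ≡ sumUpTo n g
sumUpTo-cong zero    f≡g = cong (_+ 0) (f≡g 0 z≤n)
sumUpTo-cong (suc n) f≡g = cong₂ _+_ (f≡g 0 z≤n) (sumUpTo-cong n λ i i≤n → f≡g (suc i) (s≤s i≤n))

sumUpTo-zero : ∀ n → (∑[ i ≤ n ] 0) ≡ 0
sumUpTo-zero zero    = refl
sumUpTo-zero (suc n) = sumUpTo-zero n

sumUpTo-+ : ∀ n (f g : ℕ → ℕ) → (∑[ i ≤ n ] (f i + g i)) ≡ sumUpTo n f + sumUpTo n g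
-- A one-term sum unfolds to `f 0 + 0`; the trailing zeros are what `interchange` redistributes.
sumUpTo-+ zero    f g = interchange +-commutativeSemigroup (f 0) (g 0) 0 0
sumUpTo-+ (suc n) f g = begin
  (f 0 + g 0) + (∑[ i ≤ n ] (f (suc i) + g (suc i)))
    ≡⟨ cong (f 0 + g 0 +_) (sumUpTo-+ n (λ i → f (suc i)) (λ i → g (suc i))) ⟩
  (f 0 + g 0) + ((∑[ i ≤ n ] f (suc i)) + (∑[ i ≤ n ] g (suc i)))
    ≡⟨ interchange +-commutativeSemigroup (f 0) (g 0) _ _ ⟩
  sumUpTo (suc n) f + sumUpTo (suc n) g ∎

*-distribˡ-sumUpTo : ∀ c n (f : ℕ → ℕ) → c * sumUpTo n f ≡ (∑[ i ≤ n ] c * f i)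
*-distribˡ-sumUpTo c zero    f = trans (*-distribˡ-+ c (f 0) 0) (cong (c * f 0 +_) (*-zeroʳ c))
*-distribˡ-sumUpTo c (suc n) f = trans (*-distribˡ-+ c (f 0) _)
  (cong (c * f 0 +_) (*-distribˡ-sumUpTo c n λ i → f (suc i)))

-- Induction on `m`: Pascal's rule splits every term but `j = 0` in two, giving the convolutions for
-- `m` at `k` and at `suc k`.
vandermonde : ∀ m n k → (∑[ j ≤ k ] (m C j) * (n C (k ∸ j))) ≡ (m + n) C k
vandermonde m       n zero    = refl
vandermonde zero    n (suc k) = begin
  (0 C 0) * (n C suc k) + (∑[ j ≤ k ] (0 C suc j) * (n C (k ∸ j)))
    -- `0 C suc j` computes to 0, so the tail is definitionally a sum of zeros.
    ≡⟨ cong₂ _+_ (*-identityˡ _) (sumUpTo-zero k) ⟩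
  (n C suc k) + 0
    ≡⟨ +-identityʳ _ ⟩
  n C suc k ∎
vandermonde (suc m) n (suc k) = begin
  (suc m C 0) * (n C suc k) + (∑[ j ≤ k ] (suc m C suc j) * (n C (k ∸ j)))
    ≡⟨ cong ((m C 0) * (n C suc k) +_) (sumUpTo-cong k λ j _ → pascal-step j) ⟩
  (m C 0) * (n C suc k) + (∑[ j ≤ k ] (a j + b j))
    ≡⟨ cong ((m C 0) * (n C suc k) +_) (sumUpTo-+ k a b) ⟩
  (m C 0) * (n C suc k) + (sumUpTo k a + sumUpTo k b)
    -- The split-off term is the `j = 0` term of the `suc k` convolution and `b` supplies the rest,
    -- as `suc k ∸ suc j` reduces to `k ∸ j`.
    ≡⟨ x∙yz≈y∙xz +-commutativeSemigroup ((m C 0) * (n C suc k)) (sumUpTo k a) (sumUpTo k b) ⟩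
  sumUpTo k a + (∑[ j ≤ suc k ] (m C j) * (n C (suc k ∸ j)))
    ≡⟨ cong₂ _+_ (vandermonde m n k) (vandermonde m n (suc k)) ⟩
  (m + n) C k + (m + n) C suc k
    ≡⟨ nCk+nC[k+1]≡[n+1]C[k+1] (m + n) k ⟩
  (suc m + n) C suc k ∎
  where
  a b : ℕ → ℕ
  a j = (m C j) * (n C (k ∸ j))
  b j = (m C suc j) * (n C (k ∸ j))

  pascal-step : ∀ j → (suc m C suc j) * (n C (k ∸ j)) ≡ a j + b j
  pascal-step j = trans (cong (_* (n C (k ∸ j))) (sym (nCk+nC[k+1]≡[n+1]C[k+1] m j)))
                        (*-distribʳ-+ (n C (k ∸ j)) (m C j) (m C suc j))

sum-of-squares : ∀ n → (∑[ j ≤ n ] (n C j) * (n C j)) ≡ centralBinomial n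
sum-of-squares n = begin
  (∑[ j ≤ n ] (n C j) * (n C j))
    ≡⟨ sumUpTo-cong n (λ j j≤n → cong ((n C j) *_) (nCk≡nC[n∸k] j≤n)) ⟩
  (∑[ j ≤ n ] (n C j) * (n C (n ∸ j)))
    ≡⟨ vandermonde n n n ⟩
  (n + n) C n
    ≡⟨ cong (λ m → (n + m) C n) (+-identityʳ n) ⟨
  (2 * n) C n ∎

-- The quotient defining the binomial is exact, so the factorial formula can be used without
-- division.
nCk*k![n∸k]!≡n! : ∀ {n k} → k ≤ n → (n C k) * (k ! * (n ∸ k) !) ≡ n !
nCk*k![n∸k]!≡n! {n} {k} k≤n = trans
  (cong (_* (k ! * (n ∸ k) !)) (nCk≡n!/k![n-k]! k≤n))
  (m/n*n≡m {{k !* (n ∸ k) !≢0}} (k![n∸k]!∣n! k≤n))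

-- Expanding `n !` through `n C i`, then `i !` through `i C j`, exhibits `n !` as a multiple of the
-- denominator `d`, so the division is exact.
trinomial≡C*C : ∀ {n i j} → i ≤ n → j ≤ i → trinomial n j (n ∸ i) (i ∸ j) ≡ (n C i) * (i C j)
trinomial≡C*C {n} {i} {j} i≤n j≤i = begin
  n ! / d
    ≡⟨ cong (_/ d) n!≡ ⟩
  (n C i) * (i C j) * d / d
    ≡⟨ m*n/n≡m ((n C i) * (i C j)) d ⟩
  (n C i) * (i C j) ∎
  where
  d : ℕ
  d = j ! * (n ∸ i) ! * (i ∸ j) !

  instance
    d≢0 : NonZero d
    d≢0 = m*n≢0 (j ! * (n ∸ i) !) ((i ∸ j) !) {{j !* (n ∸ i) !≢0}} {{(i ∸ j) !≢0}}

  rearrange : ∀ x y p q r → x * (y * (p * r) * q) ≡ x * y * (p * q * r)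
  rearrange = solve-∀

  n!≡ : n ! ≡ (n C i) * (i C j) * d
  n!≡ = begin
    n !
      ≡⟨ nCk*k![n∸k]!≡n! i≤n ⟨
    (n C i) * (i ! * (n ∸ i) !)
      -- Eliminates `i !`, which does not occur in `d`.
      ≡⟨ cong (λ x → (n C i) * (x * (n ∸ i) !)) (nCk*k![n∸k]!≡n! j≤i) ⟨
    (n C i) * ((i C j) * (j ! * (i ∸ j) !) * (n ∸ i) !)
      ≡⟨ rearrange (n C i) (i C j) (j !) ((n ∸ i) !) ((i ∸ j) !) ⟩
    (n C i) * (i C j) * d ∎

theorem10 : (n : ℕ) → tetrahedronTransform pascal n ≡ binomialTransform centralBinomial n
theorem10 n = sumUpTo-cong n λ i i≤n → begin
  (∑[ j ≤ i ] trinomial n j (n ∸ i) (i ∸ j) * (i C j))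
    -- One factor `i C j` comes from the trinomial, the other is the Pascal entry; together they
    -- form the square.
    ≡⟨ sumUpTo-cong i (λ j j≤i → trans (cong (_* (i C j)) (trinomial≡C*C i≤n j≤i)) (*-assoc (n C i) (i C j) (i C j))) ⟩
  (∑[ j ≤ i ] (n C i) * ((i C j) * (i C j)))
    ≡⟨ *-distribˡ-sumUpTo (n C i) i (λ j → (i C j) * (i C j)) ⟨
  (n C i) * (∑[ j ≤ i ] (i C j) * (i C j))
    ≡⟨ cong ((n C i) *_) (sum-of-squares i) ⟩
  (n C i) * centralBinomial i ∎
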